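{- The logics $\mathrm G_{3\sim}$ and $\mathrm G_{4\sim}$ are logically equivalent to the 3-valued Łukasiewicz logic $\text{Ł}_3$ and the 4-valued Łukasiewicz logic $\text{Ł}_4$, respectively.
   Context: For $m\ge 2$, $\mathbf{GV}_{m\sim}$ is the algebra on $\{0,\frac1{m-1},\dots,\frac{m-2}{m-1},1\}$ with $\wedge=\min$, $x\to y=1$ if $x\le y$ and $x\to y=y$ otherwise (Gödel implication), $\sim x=1-x$, and constant $\bot=0$. $\mathbf{ŁV}_m$ is the MV-chain on the same set with $\neg x=1-x$ and $x\to y=\min\{1,1-x+y\}$. The logics $\mathrm G_{m\sim}$ and $\text{Ł}_m$ are the (truth-preserving) logics of the matrices $\langle\mathbf{GV}_{m\sim},\{1\}\rangle$ and $\langle\mathbf{ŁV}_m,\{1\}\rangle$: $\Gamma\vdash\varphi$ iff every evaluation giving value $1$ to all formulas of $\Gamma$ gives value $1$ to $\varphi$. "Logically equivalent" means that the two logics are the same up to the choice of primitive connectives: the algebras $\mathbf{GV}_{m\sim}$ and $\mathbf{ŁV}_m$ are termwise equivalent, i.e. on their common domain every basic operation of each one is a term operation of the other. -}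

module Defs where

open import Data.Fin.Base using (Fin; toℕ; fromℕ<)
open import Data.Fin.Patterns using (0F; 1F)
open import Data.Fin.Properties using (toℕ-fromℕ<; toℕ≤pred[n])
open import Data.Irrelevant as Irrelevant using ()
open import Data.Integer.Base as ℤ using (+_)
import Data.Integer.Properties as ℤ
open import Data.Nat.Base as ℕ using (ℕ; suc; pred; NonZero; NonTrivial; _∸_)
import Data.Nat.Properties as ℕ
open import Data.Product.Base using (∃-syntax; _×_; _,_)
open import Data.Rational.Base
  using (ℚ; 0ℚ; 1ℚ; _+_; _-_; -_; _⊓_; _/_; _≤_; toℚᵘ)
open import Data.Rational.Properties
import Data.Rational.Unnormalised.Base as ℚᵘ
import Data.Rational.Unnormalised.Properties as ℚᵘ
open import Data.Refinement using (Refinement; value; proof; _,_)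
open import Data.Sum.Base using (inj₁; inj₂)
open import Data.Vec.Functional using (Vector)
open import Level using (0ℓ)
open import Relation.Binary.PropositionalEquality
open import Relation.Nullary using (yes; no)
open import Relation.Unary using (Pred)

record Signature : Set₁ where
  field
    Op    : Set
    arity : Op → ℕ

open Signature public

record Algebra (S : Signature) (A : Set) : Set where
  field
    ⟦_⟧ : (f : Op S) → Vector A (arity S f) → A

open Algebra public

-- Terms, equivalently formulas, over countably many variables.
data Term (S : Signature) : Set where
  var : ℕ → Term S
  op  : (f : Op S) → Vector (Term S) (arity S f) → Term S

eval : ∀ {S A} → Algebra S A → (ℕ → A) → Term S → A
eval 𝐀 e (var x)   = e x
eval 𝐀 e (op f ts) = ⟦ 𝐀 ⟧ f (λ i → eval 𝐀 e (ts i))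

-- The first n variables are the arguments of g. The term may contain other
-- variables provided that its value does not depend on them; this matters
-- only for n = 0, where a constant may be given by a term such as ¬ (x → x)
-- in a signature without constants.
IsTermOperation : ∀ {S A n} → Algebra S A → (Vector A n → A) → Set
IsTermOperation {A = A} 𝐀 g =
  ∃[ t ] ∀ (e : ℕ → A) → eval 𝐀 e t ≡ g (λ i → e (toℕ i))

TermwiseEquivalent : ∀ {S T A} → Algebra S A → Algebra T A → Set
TermwiseEquivalent 𝐀 𝐁 =
  (∀ f → IsTermOperation 𝐁 (⟦ 𝐀 ⟧ f)) × (∀ g → IsTermOperation 𝐀 (⟦ 𝐁 ⟧ g))

-- The logic of the matrix with domain A and designated values D. As both
-- indices are shared by two logics that are compared, being the same logic
-- up to the choice of primitive connectives is a matter of the algebras only.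
record Logic (A : Set) (D : Pred A 0ℓ) : Set₁ where
  field
    signature : Signature
    algebra   : Algebra signature A

  Formula : Set
  Formula = Term signature

  infix 4 _⊢_

  _⊢_ : Pred Formula 0ℓ → Formula → Set
  Γ ⊢ φ = ∀ e → (∀ ψ → Γ ψ → D (eval algebra e ψ)) → D (eval algebra e φ)

LogicallyEquivalent : ∀ {A D} → Logic A D → Logic A D → Set
LogicallyEquivalent L M = TermwiseEquivalent (Logic.algebra L) (Logic.algebra M)

pred-nonZero : ∀ m → .{{NonTrivial m}} → NonZero (pred m)
pred-nonZero (suc (suc _)) = _

-- TruthValue m is {0, 1/(m-1), …, (m-2)/(m-1), 1}; membership is irrelevant.
module _ (m : ℕ) .{{_ : NonTrivial m}} where

  frac : ℕ → ℚ
  frac i = (+ i / pred m) {{pred-nonZero m}}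

  IsTruthValue : ℚ → Set
  IsTruthValue q = ∃[ i ] q ≡ frac (toℕ {m} i)

  TruthValue : Set
  TruthValue = Refinement ℚ IsTruthValue

  IsOne : Pred TruthValue 0ℓ
  IsOne x = value x ≡ 1ℚ

infixr 5 _⇒ᴳ_ _⇒ᴸ_

_⇒ᴳ_ : ℚ → ℚ → ℚ
p ⇒ᴳ q with p ≤? q
... | yes _ = 1ℚ
... | no  _ = q

_⇒ᴸ_ : ℚ → ℚ → ℚ
p ⇒ᴸ q = 1ℚ ⊓ (1ℚ - p + q)

compl : ℚ → ℚ
compl p = 1ℚ - p

/-+-distrib : ∀ i j n .{{_ : NonZero n}} → + (i ℕ.+ j) / n ≡ + i / n + + j / n
/-+-distrib i j n@(suc k) = toℚᵘ-injective (begin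
  toℚᵘ (+ (i ℕ.+ j) / n)                ≈⟨ toℚᵘ-fromℚᵘ (ℚᵘ.mkℚᵘ (+ (i ℕ.+ j)) k) ⟩
  ℚᵘ.mkℚᵘ (+ (i ℕ.+ j)) k               ≈⟨ ℚᵘ.*≡* same ⟩
  ℚᵘ.mkℚᵘ (+ i) k ℚᵘ.+ ℚᵘ.mkℚᵘ (+ j) k
    ≈⟨ ℚᵘ.+-cong (toℚᵘ-fromℚᵘ (ℚᵘ.mkℚᵘ (+ i) k)) (toℚᵘ-fromℚᵘ (ℚᵘ.mkℚᵘ (+ j) k)) ⟨
  toℚᵘ (+ i / n) ℚᵘ.+ toℚᵘ (+ j / n)    ≈⟨ toℚᵘ-homo-+ (+ i / n) (+ j / n) ⟨
  toℚᵘ (+ i / n + + j / n)              ∎)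
  where
  open ℚᵘ.≃-Reasoning
  same : + (i ℕ.+ j) ℤ.* + (n ℕ.* n) ≡ (+ i ℤ.* + n ℤ.+ + j ℤ.* + n) ℤ.* + n
  same = trans (cong (+ (i ℕ.+ j) ℤ.*_) (ℤ.pos-* n n))
        (trans (sym (ℤ.*-assoc (+ (i ℕ.+ j)) (+ n) (+ n)))
               (cong (ℤ._* + n) (ℤ.*-distribʳ-+ (+ n) (+ i) (+ j))))

n/n≡1 : ∀ n .{{_ : NonZero n}} → + n / n ≡ 1ℚ
n/n≡1 n@(suc k) = toℚᵘ-injective (ℚᵘ.≃-trans (toℚᵘ-fromℚᵘ (ℚᵘ.mkℚᵘ (+ n) k))
  (ℚᵘ.*≡* (trans (ℤ.*-identityʳ (+ n)) (sym (ℤ.*-identityˡ (+ n))))))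

compl-/ : ∀ {i} n .{{_ : NonZero n}} → i ℕ.≤ n → compl (+ i / n) ≡ + (n ∸ i) / n
compl-/ {i} n i≤n = begin
  1ℚ - + i / n                         ≡⟨ cong (_- + i / n) (n/n≡1 n) ⟨
  + n / n - + i / n                    ≡⟨ cong (λ k → + k / n - + i / n) (ℕ.m∸n+n≡m i≤n) ⟨
  + (n ∸ i ℕ.+ i) / n - + i / n        ≡⟨ cong (_- + i / n) (/-+-distrib (n ∸ i) i n) ⟩
  + (n ∸ i) / n + + i / n - + i / n    ≡⟨ +-assoc (+ (n ∸ i) / n) (+ i / n) (- (+ i / n)) ⟩
  + (n ∸ i) / n + (+ i / n - + i / n)  ≡⟨ cong (λ q → + (n ∸ i) / n + q) (+-inverseʳ (+ i / n)) ⟩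
  + (n ∸ i) / n + 0ℚ                   ≡⟨ +-identityʳ (+ (n ∸ i) / n) ⟩
  + (n ∸ i) / n                        ∎
  where open ≡-Reasoning

1≤/ : ∀ {k} n .{{_ : NonZero n}} → n ℕ.≤ k → 1ℚ ≤ + k / n
1≤/ {k} n n≤k = begin
  1ℚ                       ≡⟨ n/n≡1 n ⟨
  + n / n                  ≡⟨ +-identityˡ (+ n / n) ⟨
  0ℚ + + n / n             ≤⟨ +-monoˡ-≤ (+ n / n) (nonNegative⁻¹ (+ (k ∸ n) / n) {{normalize-nonNeg (k ∸ n) n}}) ⟩
  + (k ∸ n) / n + + n / n  ≡⟨ /-+-distrib (k ∸ n) n n ⟨
  + (k ∸ n ℕ.+ n) / n      ≡⟨ cong (λ l → + l / n) (ℕ.m∸n+n≡m n≤k) ⟩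
  + k / n                  ∎
  where open ≤-Reasoning

module _ {m : ℕ} .{{_ : NonTrivial m}} where

  private
    n : ℕ
    n = pred m

    instance
      n≢0 : NonZero n
      n≢0 = pred-nonZero m

    n<m : n ℕ.< m
    n<m = ℕ.≤-reflexive (ℕ.suc-pred m {{ℕ.nonTrivial⇒nonZero m}})

  frac-member : ∀ {i} → i ℕ.≤ n → IsTruthValue m (frac m i)
  frac-member {i} i≤n = fromℕ< i<m , cong (frac m) (sym (toℕ-fromℕ< i<m))
    where
    i<m : i ℕ.< m
    i<m = ℕ.≤-<-trans i≤n n<m

  0-member : IsTruthValue m 0ℚ
  0-member = subst (IsTruthValue m) (0/n≡0 n) (frac-member ℕ.z≤n)

  1-member : IsTruthValue m 1ℚ
  1-member = subst (IsTruthValue m) (n/n≡1 n) (frac-member ℕ.≤-refl)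

  ⊓-member : ∀ {p q} → IsTruthValue m p → IsTruthValue m q → IsTruthValue m (p ⊓ q)
  ⊓-member {p} {q} p∈ q∈ with ⊓-sel p q
  ... | inj₁ eq = subst (IsTruthValue m) (sym eq) p∈
  ... | inj₂ eq = subst (IsTruthValue m) (sym eq) q∈

  ⇒ᴳ-member : ∀ p {q} → IsTruthValue m q → IsTruthValue m (p ⇒ᴳ q)
  ⇒ᴳ-member p {q} q∈ with p ≤? q
  ... | yes _ = 1-member
  ... | no  _ = q∈

  compl-member : ∀ {p} → IsTruthValue m p → IsTruthValue m (compl p)
  compl-member (i , refl) = subst (IsTruthValue m)
    (sym (compl-/ n (toℕ≤pred[n] i))) (frac-member (ℕ.m∸n≤m n (toℕ i)))

  ⇒ᴸ-member : ∀ {p q} → IsTruthValue m p → IsTruthValue m q → IsTruthValue m (p ⇒ᴸ q)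
  ⇒ᴸ-member (i , refl) (j , refl) =
    subst (λ r → IsTruthValue m (1ℚ ⊓ r)) (sym sum) 1⊓-member
    where
    k : ℕ
    k = n ∸ toℕ i ℕ.+ toℕ j

    sum : 1ℚ - frac m (toℕ i) + frac m (toℕ j) ≡ frac m k
    sum = trans (cong (_+ frac m (toℕ j)) (compl-/ n (toℕ≤pred[n] i)))
                (sym (/-+-distrib (n ∸ toℕ i) (toℕ j) n))

    1⊓-member : IsTruthValue m (1ℚ ⊓ frac m k)
    1⊓-member with ℕ.≤-total k n
    ... | inj₁ k≤n = ⊓-member 1-member (frac-member k≤n)
    ... | inj₂ n≤k = subst (IsTruthValue m) (sym (p≤q⇒p⊓q≡p (1≤/ n n≤k))) 1-member

data GOp : Set where
  ∧ᴳ →ᴳ ∼ᴳ ⊥ᴳ : GOp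

data ŁOp : Set where
  ¬ᴸ →ᴸ : ŁOp

G-signature : Signature
G-signature .Op       = GOp
G-signature .arity ∧ᴳ = 2
G-signature .arity →ᴳ = 2
G-signature .arity ∼ᴳ = 1
G-signature .arity ⊥ᴳ = 0

Ł-signature : Signature
Ł-signature .Op       = ŁOp
Ł-signature .arity ¬ᴸ = 1
Ł-signature .arity →ᴸ = 2

module _ (m : ℕ) .{{_ : NonTrivial m}} where

  GV∼ : Algebra G-signature (TruthValue m)
  ⟦ GV∼ ⟧ ∧ᴳ xs = value (xs 0F) ⊓ value (xs 1F) , Irrelevant.zipWith ⊓-member (proof (xs 0F)) (proof (xs 1F))
  ⟦ GV∼ ⟧ →ᴳ xs = value (xs 0F) ⇒ᴳ value (xs 1F) , Irrelevant.map (⇒ᴳ-member (value (xs 0F))) (proof (xs 1F))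
  ⟦ GV∼ ⟧ ∼ᴳ xs = compl (value (xs 0F)) , Irrelevant.map compl-member (proof (xs 0F))
  ⟦ GV∼ ⟧ ⊥ᴳ xs = 0ℚ , Irrelevant.pure 0-member

  ŁV : Algebra Ł-signature (TruthValue m)
  ⟦ ŁV ⟧ ¬ᴸ xs = compl (value (xs 0F)) , Irrelevant.map compl-member (proof (xs 0F))
  ⟦ ŁV ⟧ →ᴸ xs = value (xs 0F) ⇒ᴸ value (xs 1F) , Irrelevant.zipWith ⇒ᴸ-member (proof (xs 0F)) (proof (xs 1F))

  G∼ : Logic (TruthValue m) (IsOne m)
  G∼ = record { signature = G-signature ; algebra = GV∼ }

  Ł : Logic (TruthValue m) (IsOne m)
  Ł = record { signature = Ł-signature ; algebra = ŁV }

{-# OPTIONS --safe #-}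

-- The same terms serve for m = 3 and m = 4. In ŁV m with m ≤ 4, the cube
-- Δ x = x ⊙ x ⊙ x is 1 for x = 1 and 0 otherwise, so that the Gödel implication
-- is Δ (x → y) ∨ y. Conversely, for x > y the value 1 - x + y is the maximum
-- of 1 - x and y, except for x = 2/3 and y = 1/3, where it is x. The meet
-- x ∧ (y → ∼ x) ∧ ¬ ¬ y in GV∼ m takes the value 2/3 there and 0 for all other
-- x > y.

module Submission where

open import Defs
open import Data.Nat.Base using (ℕ; zero; suc; NonTrivial; nonTrivial)
open import Data.Fin.Base using (Fin; toℕ)
import Data.Fin.Properties as Fin
open import Data.Irrelevant using ([_])
open import Data.Product.Base using (_×_; _,_)
import Data.Rational.Properties as ℚ
open import Data.Refinement using (_,_)
open import Data.Refinement.Properties using (_≟_)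
open import Data.Vec.Functional using ([]; _∷_)
open import Function.Base using (_∘_)
open import Relation.Binary.PropositionalEquality using (_≡_; refl)
open import Relation.Nullary using (Dec)
open import Relation.Nullary.Decidable using (map′; recompute; toWitness; _×-dec_)
open import Relation.Unary using (Pred; Decidable)
open import Level using (0ℓ)

module _ {m : ℕ} .{{_ : NonTrivial m}} where

  fromIndex : Fin m → TruthValue m
  fromIndex i = frac m (toℕ i) , [ i , refl ]

  isTruthValue? : Decidable (IsTruthValue m)
  isTruthValue? q = Fin.any? (λ i → q ℚ.≟ frac m (toℕ i))

  all? : {P : Pred (TruthValue m) 0ℓ} → Decidable P → Dec (∀ x → P x)
  all? {P} P? = map′ extend (_∘ fromIndex) (Fin.all? (P? ∘ fromIndex))
    where
    extend : (∀ i → P (fromIndex i)) → ∀ x → P x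
    -- The index inside an irrelevant membership proof cannot be extracted; deciding membership
    -- finds one again by search.
    extend Pi (q , [ q∈ ]) with recompute (isTruthValue? q) q∈
    ... | i , refl = Pi i

infixr 6 _⇒ᵍ_
infixr 7 _∨ᵍ_
infixr 8 _∧ᵍ_

_∧ᵍ_ _⇒ᵍ_ _∨ᵍ_ : (s t : Term G-signature) → Term G-signature
∼ᵍ_ ¬ᵍ_ : Term G-signature → Term G-signature
s ∧ᵍ t = op ∧ᴳ (s ∷ t ∷ [])
s ⇒ᵍ t = op →ᴳ (s ∷ t ∷ [])
∼ᵍ t   = op ∼ᴳ (t ∷ [])
¬ᵍ t   = t ⇒ᵍ op ⊥ᴳ []
s ∨ᵍ t = ∼ᵍ (∼ᵍ s ∧ᵍ ∼ᵍ t)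

infixr 6 _⇒ˡ_
infixr 7 _∨ˡ_
infixr 8 _⊙ˡ_

_⇒ˡ_ _∨ˡ_ _⊙ˡ_ : (s t : Term Ł-signature) → Term Ł-signature
¬ˡ_ Δˡ_ : Term Ł-signature → Term Ł-signature
s ⇒ˡ t = op →ᴸ (s ∷ t ∷ [])
¬ˡ t   = op ¬ᴸ (t ∷ [])
s ∨ˡ t = (s ⇒ˡ t) ⇒ˡ t
s ⊙ˡ t = ¬ˡ (s ⇒ˡ ¬ˡ t)
Δˡ t   = t ⊙ˡ t ⊙ˡ t

G-in-Ł : GOp → Term Ł-signature
G-in-Ł ∧ᴳ = ¬ˡ (¬ˡ var 0 ∨ˡ ¬ˡ var 1)
G-in-Ł →ᴳ = Δˡ (var 0 ⇒ˡ var 1) ∨ˡ var 1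
G-in-Ł ∼ᴳ = ¬ˡ var 0
G-in-Ł ⊥ᴳ = ¬ˡ (var 0 ⇒ˡ var 0)

Ł-in-G : ŁOp → Term G-signature
Ł-in-G ¬ᴸ = ∼ᵍ var 0
-- In the last meet, `¬ᵍ ¬ᵍ y` removes y = 0, and `y ⇒ᵍ ∼ᵍ x` removes x = 1 with y > 0. If x ≤ y,
-- then `x ⇒ᵍ y` is already 1.
Ł-in-G →ᴸ = (x ⇒ᵍ y) ∨ᵍ ∼ᵍ x ∨ᵍ (x ∧ᵍ (y ⇒ᵍ ∼ᵍ x) ∧ᵍ ¬ᵍ ¬ᵍ y)
  where
  x y : Term G-signature
  x = var 0
  y = var 1

assign : ∀ {A : Set} → A → A → ℕ → A
assign x y zero    = x
assign x y (suc _) = y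

module _ (m : ℕ) .{{_ : NonTrivial m}} where

  -- Two values in place of an evaluation on all of ℕ make the condition decidable; they suffice for
  -- terms in variables 0 and 1.
  Defines : ∀ {S T} → Algebra S (TruthValue m) → Algebra T (TruthValue m) →
            Term S → Op T → Set
  Defines 𝐀 𝐁 t f = ∀ x y → eval 𝐀 (assign x y) t ≡ ⟦ 𝐁 ⟧ f (assign x y ∘ toℕ)

  defines? : ∀ {S T} (𝐀 : Algebra S (TruthValue m)) (𝐁 : Algebra T (TruthValue m)) →
             ∀ t f → Dec (Defines 𝐀 𝐁 t f)
  defines? 𝐀 𝐁 t f = all? (λ x → all? (λ y →
    eval 𝐀 (assign x y) t ≟ᵗ ⟦ 𝐁 ⟧ f (assign x y ∘ toℕ)))
    where _≟ᵗ_ = _≟_ ℚ._≟_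

  -- The negations are absent because both algebras interpret them by `compl`, so that `refl`
  -- settles them.
  Translations : Set
  Translations =
    Defines (ŁV m) (GV∼ m) (G-in-Ł ∧ᴳ) ∧ᴳ ×
    Defines (ŁV m) (GV∼ m) (G-in-Ł →ᴳ) →ᴳ ×
    Defines (ŁV m) (GV∼ m) (G-in-Ł ⊥ᴳ) ⊥ᴳ ×
    Defines (GV∼ m) (ŁV m) (Ł-in-G →ᴸ) →ᴸ

  translations? : Dec Translations
  translations? = defines? (ŁV m) (GV∼ m) (G-in-Ł ∧ᴳ) ∧ᴳ
            ×-dec defines? (ŁV m) (GV∼ m) (G-in-Ł →ᴳ) →ᴳ
            ×-dec defines? (ŁV m) (GV∼ m) (G-in-Ł ⊥ᴳ) ⊥ᴳ
            ×-dec defines? (GV∼ m) (ŁV m) (Ł-in-G →ᴸ) →ᴸ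

  logicallyEquivalent : Translations → LogicallyEquivalent (G∼ m) (Ł m)
  logicallyEquivalent (∧-eq , ⇒-eq , ⊥-eq , →-eq) = G-in-Ł-correct , Ł-in-G-correct
    where
    G-in-Ł-correct : ∀ f → IsTermOperation (ŁV m) (⟦ GV∼ m ⟧ f)
    -- The term is concrete, so its values under `e` and under `assign (e 0) (e 1)` agree by
    -- computation.
    G-in-Ł-correct ∧ᴳ = G-in-Ł ∧ᴳ , λ e → ∧-eq (e 0) (e 1)
    G-in-Ł-correct →ᴳ = G-in-Ł →ᴳ , λ e → ⇒-eq (e 0) (e 1)
    G-in-Ł-correct ∼ᴳ = G-in-Ł ∼ᴳ , λ e → refl
    G-in-Ł-correct ⊥ᴳ = G-in-Ł ⊥ᴳ , λ e → ⊥-eq (e 0) (e 1)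

    Ł-in-G-correct : ∀ f → IsTermOperation (GV∼ m) (⟦ ŁV m ⟧ f)
    Ł-in-G-correct ¬ᴸ = Ł-in-G ¬ᴸ , λ e → refl
    Ł-in-G-correct →ᴸ = Ł-in-G →ᴸ , λ e → →-eq (e 0) (e 1)

proposition2 : LogicallyEquivalent (G∼ 3) (Ł 3) × LogicallyEquivalent (G∼ 4) (Ł 4)
-- Type checking runs the decision over all 9, respectively 16, pairs of truth values.
proposition2 = logicallyEquivalent 3 (toWitness {a? = translations? 3} _)
             , logicallyEquivalent 4 (toWitness {a? = translations? 4} _)
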